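{- Let $G$ be a bidirected graph and let $\alpha\in\{+,-\}$. Define a binary relation $\sim_\alpha$ on $V(G)$ by: $u\sim_\alpha v$ if $u=v$, or if $u$ and $v$ are circularly connected in $G$ and $G$ has no $(\alpha,\alpha)$-ditrail between $u$ and $v$. Then $\sim_\alpha$ is an equivalence relation on $V(G)$.
   Context: All graphs are finite (parallel edges and loops allowed). A bidirected graph is a graph $G$ together with two maps $\sigma^+,\sigma^-$ on $E(G)$ such that for each edge $e$ with ends $u,v$: $\sigma^+(e),\sigma^-(e)\subseteq\{u,v\}$ (one may be empty), $\sigma^+(e)\cup\sigma^-(e)=\{u,v\}$, and if $u\neq v$ then $\sigma^+(e)\cap\sigma^-(e)=\emptyset$. We say $\gamma\in\{+,-\}$ is a sign of $u$ over $e$ if $u\in\sigma^\gamma(e)$. A walk from $u$ to $v$ is a sequence $(s_1,\dots,s_k)$, $k\ge1$ odd, where the odd-indexed terms are vertices with $s_1=u$, $s_k=v$, and each even-indexed term $s_i$ is an edge joining $s_{i-1}$ and $s_{i+1}$; a trail is a walk whose edges are all distinct; it is closed if $s_1=s_k$. A trail $(s_1,\dots,s_k)$ is a ditrail if for every odd $i$ with $1<i<k$ the signs of $s_i$ over $s_{i-1}$ and over $s_{i+1}$ are distinct. For $\alpha,\beta\in\{+,-\}$, an $(\alpha,\beta)$-ditrail is a ditrail with $k>1$ in which the sign of $s_1$ over $s_2$ is $\alpha$ and the sign of $s_k$ over $s_{k-1}$ is $\beta$; in addition, the one-term trail $(s_1)$ is considered an $(\alpha,\beta)$-ditrail for every $\alpha\neq\beta$.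 An $(\alpha,\alpha)$-ditrail between $u$ and $v$ means an $(\alpha,\alpha)$-ditrail from $u$ to $v$ (equivalently, by reversal, from $v$ to $u$). A cyclic ditrail is a closed $(\gamma,-\gamma)$-ditrail for some $\gamma\in\{+,-\}$. An edge is circular if some cyclic ditrail contains it. Two vertices are circularly connected if there is a path between them all of whose edges are circular. -}

module Defs where

open import Data.Nat using (ℕ)
open import Data.Fin using (Fin)
open import Data.Bool using (Bool; T)
open import Data.Unit using (⊤)
open import Data.Empty using (⊥)
open import Data.Product using (Σ; ∃; _×_; _,_; proj₁; proj₂)
open import Data.Sum using (_⊎_)
open import Data.List using (List; []; _∷_; map)
open import Data.List.Relation.Unary.All using (All)
open import Data.List.Relation.Unary.Unique.Propositional using (Unique)
open import Data.List.Membership.Propositional using (_∈_)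
open import Relation.Nullary using (¬_)
open import Relation.Binary.PropositionalEquality using (_≡_; _≢_)

data Sign : Set where
  ⊕ ⊝ : Sign

neg : Sign → Sign
neg ⊕ = ⊝
neg ⊝ = ⊕

-- A finite bidirected graph: vertices Fin nV, edges Fin nE (parallel edges
-- and loops allowed).  Edge e has ends end₁ e and end₂ e.  σ γ e is the
-- subset σ^γ(e) of V, given by its characteristic function.
record BiGraph : Set where
  field
    nV nE : ℕ
    end₁ end₂ : Fin nE → Fin nV
    σ : Sign → Fin nE → Fin nV → Bool
    σ-⊆ : ∀ γ e w → T (σ γ e w) → w ≡ end₁ e ⊎ w ≡ end₂ e
    σ-∪ : ∀ e w → w ≡ end₁ e ⊎ w ≡ end₂ e → T (σ ⊕ e w) ⊎ T (σ ⊝ e w)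
    σ-∩ : ∀ e → end₁ e ≢ end₂ e → ∀ w → T (σ ⊕ e w) → T (σ ⊝ e w) → ⊥

module _ (G : BiGraph) where
  open BiGraph G

  V E : Set
  V = Fin nV
  E = Fin nE

  SignOf : Sign → V → E → Set
  SignOf γ w e = T (σ γ e w)

  Joins : E → V → V → Set
  Joins e x y = (x ≡ end₁ e × y ≡ end₂ e) ⊎ (x ≡ end₂ e × y ≡ end₁ e)

  -- A walk (s₁, s₂, …, s_k) is represented by its first vertex s₁ together
  -- with the list of steps ((s₂,s₃), (s₄,s₅), …, (s_{k-1},s_k)).
  Step : Set
  Step = E × V

  IsWalk : V → List Step → Set
  IsWalk x [] = ⊤
  IsWalk x ((e , y) ∷ ss) = Joins e x y × IsWalk y ss

  lastV : V → List Step → V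
  lastV x [] = x
  lastV x ((e , y) ∷ ss) = lastV y ss

  edges : List Step → List E
  edges = map proj₁

  vertices : V → List Step → List V
  vertices x ss = x ∷ map proj₂ ss

  Internal : List Step → Set
  Internal [] = ⊤
  Internal ((e , y) ∷ []) = ⊤
  Internal ((e , y) ∷ (f , z) ∷ ss) =
    (Σ Sign λ γ → Σ Sign λ δ → γ ≢ δ × SignOf γ y e × SignOf δ y f)
    × Internal ((f , z) ∷ ss)

  LastSign : Sign → E → V → List Step → Set
  LastSign β e y [] = SignOf β y e
  LastSign β e y ((f , z) ∷ ss) = LastSign β f z ss

  EndCond : Sign → Sign → V → List Step → Set
  EndCond α β u [] = α ≢ β
  EndCond α β u ((e , y) ∷ ss) = SignOf α u e × LastSign β e y ss

  IsDitrail : Sign → Sign → V → V → List Step → Set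
  IsDitrail α β u v ss =
    IsWalk u ss × lastV u ss ≡ v × Unique (edges ss)
    × Internal ss × EndCond α β u ss

  Ditrail : Sign → Sign → V → V → Set
  Ditrail α β u v = Σ (List Step) (IsDitrail α β u v)

  Circular : E → Set
  Circular e = Σ V λ u → Σ Sign λ γ → Σ (List Step) λ ss →
    IsDitrail γ (neg γ) u u ss × e ∈ edges ss

  IsPath : V → V → List Step → Set
  IsPath u v ss = IsWalk u ss × lastV u ss ≡ v × Unique (vertices u ss)

  CircularlyConnected : V → V → Set
  CircularlyConnected u v = Σ (List Step) λ ss →
    IsPath u v ss × All Circular (edges ss)

  Sim : Sign → V → V → Set
  Sim α u v = u ≡ v ⊎ (CircularlyConnected u v × ¬ Ditrail α α u v)

{-# OPTIONS --safe #-}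
-- Track the pair (vertex, sign with which the ditrail must leave it): ditrails
-- become trails of a category, where an (α,β)-ditrail goes from (u,α) to
-- (v,−β) and a cyclic ditrail is an endomorphism.
--
-- If a ditrail Q from v ends on a ditrail P, cut Q where it first meets P.
-- There P passes with opposite signs, so Q can be continued along P in one of
-- the two directions, up to an end of P.  Applied to a cyclic ditrail
-- through an edge xy, rotated to start at y, this turns a ditrail from v to x into
-- one from v to y with the same first sign; hence, for either first sign, v
-- reaches every vertex circularly connected to it.  Applied to an
-- (α,α)-ditrail P from u to w and a ditrail from v to u with first sign α, it
-- gives an (α,α)-ditrail from v to u or to w, which is transitivity.
module Submission where

open import Defs
open import Relation.Binary.Structures using (IsEquivalence)

open import Data.Empty using (⊥-elim)
open import Data.Fin.Properties using (_≟_)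
open import Data.List using (List; []; _∷_; _++_; reverse)
open import Data.List.Membership.DecPropositional using (_∈?_)
open import Data.List.Membership.Propositional using (_∈_)
open import Data.List.Membership.Propositional.Properties using (∈-++⁺ˡ; ∈-++⁺ʳ)
open import Data.List.Properties using (unfold-reverse)
open import Data.List.Relation.Binary.Disjoint.Propositional using (Disjoint)
open import Data.List.Relation.Binary.Permutation.Propositional using (_↭_; ↭⇒↭ₛ; ↭-sym)
open import Data.List.Relation.Binary.Permutation.Propositional.Properties
  using (++-comm; ↭-reverse; ∈-resp-↭)
open import Data.List.Relation.Binary.Permutation.Setoid.Properties using (Unique-resp-↭)
open import Data.List.Relation.Binary.Subset.Propositional using (_⊆_)
open import Data.List.Relation.Unary.All using (All; []; _∷_)
open import Data.List.Relation.Unary.All.Properties using (anti-mono; ¬Any⇒All¬)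
open import Data.List.Relation.Unary.AllPairs using ([]; _∷_)
open import Data.List.Relation.Unary.Any using (here; there)
open import Data.List.Relation.Unary.Unique.Propositional using (Unique)
open import Data.List.Relation.Unary.Unique.Propositional.Properties using (++⁺)
open import Data.Product using (Σ; ∃; ∃₂; _×_; _,_)
open import Data.Sum using (_⊎_; inj₁; inj₂; [_,_]′)
open import Data.Unit using (tt)
open import Function using (_∘_)
open import Relation.Binary.Construct.Closure.ReflexiveTransitive
  using (Star; ε; _◅_; _◅◅_) renaming (reverse to reverseStar)
open import Relation.Binary.PropositionalEquality
  using (_≡_; _≢_; refl; sym; trans; subst; setoid)
open import Relation.Nullary using (yes; no)

neg-involutive : ∀ γ → neg (neg γ) ≡ γ
neg-involutive ⊕ = refl
neg-involutive ⊝ = refl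

γ≢negγ : ∀ γ → γ ≢ neg γ
γ≢negγ ⊕ ()
γ≢negγ ⊝ ()

≢⇒≡neg : ∀ {γ δ} → γ ≢ δ → δ ≡ neg γ
≢⇒≡neg {⊕} {⊕} γ≢δ = ⊥-elim (γ≢δ refl)
≢⇒≡neg {⊕} {⊝} γ≢δ = refl
≢⇒≡neg {⊝} {⊕} γ≢δ = refl
≢⇒≡neg {⊝} {⊝} γ≢δ = ⊥-elim (γ≢δ refl)

≡⊎≡neg : ∀ γ δ → γ ≡ δ ⊎ γ ≡ neg δ
≡⊎≡neg ⊕ ⊕ = inj₁ refl
≡⊎≡neg ⊕ ⊝ = inj₂ refl
≡⊎≡neg ⊝ ⊕ = inj₂ refl
≡⊎≡neg ⊝ ⊝ = inj₁ refl

unique-resp-↭ : ∀ {A : Set} {xs ys : List A} → xs ↭ ys → Unique xs → Unique ys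
unique-resp-↭ p = Unique-resp-↭ (setoid _) (↭⇒↭ₛ p)

unique-++ˡ : ∀ {A : Set} (xs : List A) {ys} → Unique (xs ++ ys) → Unique xs
unique-++ˡ []       _            = []
unique-++ˡ (x ∷ xs) (x∉ ∷ uniq) = anti-mono ∈-++⁺ˡ x∉ ∷ unique-++ˡ xs uniq

unique-++ʳ : ∀ {A : Set} (xs : List A) {ys} → Unique (xs ++ ys) → Unique ys
unique-++ʳ []       uniq       = uniq
unique-++ʳ (x ∷ xs) (_ ∷ uniq) = unique-++ʳ xs uniq

module _ (G : BiGraph) where
  private variable
    α β γ s t : Sign
    u v w x y z : V G
    e : E G
    es fs : List (E G)

  joins-sym : Joins G e x y → Joins G e y x
  joins-sym (inj₁ (p , q)) = inj₂ (q , p)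
  joins-sym (inj₂ (p , q)) = inj₁ (q , p)

  joins-end : Joins G e x y → Joins G e v w → v ≡ x ⊎ v ≡ y
  joins-end (inj₁ (refl , refl)) (inj₁ (p , _)) = inj₁ p
  joins-end (inj₁ (refl , refl)) (inj₂ (p , _)) = inj₂ p
  joins-end (inj₂ (refl , refl)) (inj₁ (p , _)) = inj₂ p
  joins-end (inj₂ (refl , refl)) (inj₂ (p , _)) = inj₁ p

  -- Route s t x y es: a walk along es that leaves x with sign s and after
  -- which a continuation must leave y with sign t.
  data Route : Sign → Sign → V G → V G → List (E G) → Set where
    nil  : Route s s x x []
    cons : Joins G e x y → SignOf G s x e → SignOf G γ y e →
           Route (neg γ) t y z es → Route s t x z (e ∷ es)

  _⊙_ : ∀ {r} → Route s r x y es → Route r t y z fs → Route s t x z (es ++ fs)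
  nil            ⊙ q = q
  cons j σx σy p ⊙ q = cons j σx σy (p ⊙ q)

  reverseRoute : Route s t x y es → Route (neg t) (neg s) y x (reverse es)
  reverseRoute nil = nil
  reverseRoute {es = e ∷ es} (cons {γ = γ} j σx σy p) =
    subst (Route _ _ _ _) (sym (unfold-reverse e es))
      (subst (λ r → Route _ r _ _ _) (neg-involutive γ) (reverseRoute p)
        ⊙ cons (joins-sym j) σy σx nil)

  fromSteps : ∀ ss → IsWalk G u ss → lastV G u ss ≡ v → Internal G ss →
              EndCond G α β u ss → Route α (neg β) u v (edges G ss)
  -- The convention for one-term trails turns them into identities: `α ≢ β` forces `α` to be
  -- `neg β`.
  fromSteps {α = α} [] _ refl _ α≢β =
    subst (λ r → Route α r _ _ []) (≢⇒≡neg (α≢β ∘ sym)) nil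
  fromSteps ((e , y) ∷ []) (j , _) refl _ (σu , σy) = cons j σu σy nil
  fromSteps ((e , y) ∷ (f , z) ∷ ss) (j , walk) last ((γ , δ , γ≢δ , σy , σy′) , int) (σu , σlast) =
    cons j σu σy (fromSteps ((f , z) ∷ ss) walk last int
      (subst (λ r → SignOf G r y f) (≢⇒≡neg γ≢δ) σy′ , σlast))

  toSteps : Route α (neg β) u v es →
            Σ (List (Step G)) λ ss → IsWalk G u ss × lastV G u ss ≡ v ×
              edges G ss ≡ es × Internal G ss × EndCond G α β u ss
  toSteps {β = β} nil = [] , tt , refl , refl , tt , γ≢negγ β ∘ sym
  toSteps {β = β} (cons {e = e} {y = y} {γ = γ} j σx σy p) with toSteps {β = β} p
  -- The end condition of an empty rest is `neg γ ≢ β`, so `β` is `γ`, the sign with which `e`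
  -- arrives at `y`.
  ... | [] , _ , last , refl , _ , negγ≢β =
    (e , y) ∷ [] , (j , tt) , last , refl , tt ,
    (σx , subst (λ δ → SignOf G δ y e) (sym (trans (≢⇒≡neg negγ≢β) (neg-involutive γ))) σy)
  ... | (f , z) ∷ ss , walk , last , refl , int , (σy′ , σlast) =
    (e , y) ∷ (f , z) ∷ ss , (j , walk) , last , refl ,
    ((γ , neg γ , γ≢negγ γ , σy , σy′) , int) , (σx , σlast)

  Trail : Sign → Sign → V G → V G → Set
  Trail s t x y = ∃ λ es → Route s t x y es × Unique es

  ditrail⇒trail : Ditrail G α β u v → Trail α (neg β) u v
  ditrail⇒trail (ss , walk , last , uniq , int , end) =
    edges G ss , fromSteps ss walk last int end , uniq

  trail⇒ditrail : Trail α (neg β) u v → Ditrail G α β u v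
  trail⇒ditrail {β = β} (_ , p , uniq) with toSteps {β = β} p
  ... | ss , walk , last , refl , int , end = ss , walk , last , uniq , int , end

  reverseTrail : Trail s t x y → Trail (neg t) (neg s) y x
  reverseTrail (es , p , uniq) =
    reverse es , reverseRoute p , unique-resp-↭ (↭-sym (↭-reverse es)) uniq

  ditrail-sym : Ditrail G α α u v → Ditrail G α α v u
  ditrail-sym {α = α} d =
    trail⇒ditrail (subst (λ r → Trail r (neg α) _ _) (neg-involutive α)
      (reverseTrail (ditrail⇒trail d)))

  -- Records one visit to `w`, which a trail may visit several times; `r` is the sign for leaving
  -- `w` at this visit.
  data SplitAt (w : V G) (s t : Sign) (x y : V G) : List (E G) → Set where
    split : ∀ {r} → Route s r x w es → Route r t w y fs → SplitAt w s t x y (es ++ fs)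

  split-at-end : Route s t x y es → e ∈ es → Joins G e v w → SplitAt v s t x y es
  split-at-end p@(cons j σx σy q) (here refl) j′ with joins-end j j′
  ... | inj₁ refl = split nil p
  ... | inj₂ refl = split (cons j σx σy nil) q
  split-at-end (cons j σx σy p) (there e∈) j′ with split-at-end p e∈ j′
  ... | split p₁ p₂ = split (cons j σx σy p₁) p₂

  -- Induction along Q, stopping before its first edge that lies on P, or at its end if there is
  -- none; the given split at `w` serves the latter case. Earlier common vertices do no harm, since
  -- only edges must be distinct. The inclusion `qs′ ⊆ qs` carries distinctness of edges over to the
  -- shortened trail.
  cut-at-hit : ∀ {s′ t′ qs} → Route s t v w qs → Unique qs →
               Route s′ t′ x y es → SplitAt w s′ t′ x y es →
               ∃₂ λ z r → ∃ λ qs′ → qs′ ⊆ qs × Route s r v z qs′ × Unique qs′ ×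
                 Disjoint qs′ es × SplitAt z s′ t′ x y es
  cut-at-hit nil _ p sp = _ , _ , [] , (λ ()) , nil , [] , (λ { (() , _) }) , sp
  cut-at-hit {es = es} {qs = e ∷ qs} (cons j σx σy q) (e∉qs ∷ uniq) p sp with _∈?_ _≟_ e es
  ... | yes e∈es =
    _ , _ , [] , (λ ()) , nil , [] , (λ { (() , _) }) , split-at-end p e∈es j
  ... | no e∉es with cut-at-hit q uniq p sp
  ...   | z , r , qs′ , qs′⊆qs , q′ , uniq′ , disj , sp′ =
    z , r , e ∷ qs′ ,
    (λ { (here eq) → here eq ; (there i) → there (qs′⊆qs i) }) ,
    cons j σx σy q′ , anti-mono qs′⊆qs e∉qs ∷ uniq′ ,
    (λ { (here refl , i) → e∉es i ; (there i , k) → disj (i , k) }) , sp′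

  divert : ∀ {s′ t′} → Trail s t v w →
           Route s′ t′ x y es → Unique es → SplitAt w s′ t′ x y es →
           Trail s t′ v y ⊎ Trail s (neg s′) v x
  divert (_ , q , uniqQ) p uniqP sp with cut-at-hit q uniqQ p sp
  ... | z , r , qs , _ , q′ , uniq′ , disj , split {es = ps₁} {fs = ps₂} {r = m} p₁ p₂
    -- Q must leave `z` with `r`; P leaves it with `m` going forwards and with `neg m` going
    -- backwards, so exactly one direction fits.
    with ≡⊎≡neg r m
  ... | inj₁ refl = inj₁
    (_ , q′ ⊙ p₂ , ++⁺ uniq′ (unique-++ʳ ps₁ uniqP) λ (i , k) → disj (i , ∈-++⁺ʳ ps₁ k))
  ... | inj₂ refl = inj₂
    (_ , q′ ⊙ reverseRoute p₁ ,
     ++⁺ uniq′ (unique-resp-↭ (↭-sym (↭-reverse ps₁)) (unique-++ˡ ps₁ uniqP))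
       λ (i , k) → disj (i , ∈-++⁺ˡ (∈-resp-↭ (↭-reverse ps₁) k)))

  -- The end sign is left free, as a diversion along a cyclic ditrail may end with either sign.
  Reach : Sign → V G → V G → Set
  Reach s v x = ∃ λ t → Trail s t v x

  -- Chains of this relation may repeat vertices, so unlike paths they concatenate freely.
  CircularAdj : V G → V G → Set
  CircularAdj x y = ∃ λ e → Joins G e x y × Circular G e

  circularAdj-sym : CircularAdj x y → CircularAdj y x
  circularAdj-sym (e , j , c) = e , joins-sym j , c

  reach-step : Reach s v x → CircularAdj x y → Reach s v y
  reach-step {x = x} {y = y} (_ , q) (e , j , z , γ , ss , (walk , last , uniq , int , end) , e∈) =
    rotate (split-at-end c e∈ (joins-sym j)) uniq e∈
    where
    c : Route γ γ z z (edges G ss)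
    -- Equal signs at both ends allow the two parts of `c` to be glued in the opposite order,
    -- `c₂ ⊙ c₁`.
    c = subst (λ r → Route γ r z z (edges G ss)) (neg-involutive γ) (fromSteps ss walk last int end)

    rotate : SplitAt y γ γ z z es → Unique es → e ∈ es → Reach _ _ y
    rotate (split {es = es₁} {fs = es₂} c₁ c₂) uniq e∈ =
      -- The rotated route starts and ends at `y`, so both directions of the diversion lead to `y`.
      [ (λ p → _ , p) , (λ p → _ , p) ]′
        (divert q (c₂ ⊙ c₁) (unique-resp-↭ (++-comm es₁ es₂) uniq)
          (split-at-end (c₂ ⊙ c₁) (∈-resp-↭ (++-comm es₁ es₂) e∈) j))

  reach-star : Reach s v x → Star CircularAdj x y → Reach s v y
  reach-star q ε        = q
  reach-star q (a ◅ as) = reach-star (reach-step q a) as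

  CC⇒star : CircularlyConnected G u v → Star CircularAdj u v
  CC⇒star (ss , (walk , last , _) , circ) = go ss walk last circ
    where
    go : ∀ ss → IsWalk G x ss → lastV G x ss ≡ y → All (Circular G) (edges G ss) →
         Star CircularAdj x y
    go []             _          refl _          = ε
    go ((e , _) ∷ ss) (j , walk) last (c ∷ circ) = (e , j , c) ◅ go ss walk last circ

  path-suffix : ∀ ss → IsPath G u v ss → All (Circular G) (edges G ss) →
                x ∈ vertices G u ss → CircularlyConnected G x v
  path-suffix ss path circ (here refl) = ss , path , circ
  path-suffix (_ ∷ ss) ((_ , walk) , last , _ ∷ uniq) (_ ∷ circ) (there x∈) =
    path-suffix ss (walk , last , uniq) circ x∈

  -- Loop erasure: if `u` already lies on the path from `y`, the suffix of that path from `u` is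
  -- taken.
  star⇒CC : Star CircularAdj u v → CircularlyConnected G u v
  star⇒CC ε = [] , (tt , refl , [] ∷ []) , []
  star⇒CC {u = u} (_◅_ {j = y} (e , j , c) as) with star⇒CC as
  ... | ss , path@(walk , last , uniq) , circ with _∈?_ _≟_ u (vertices G y ss)
  ...   | yes u∈ = path-suffix ss path circ u∈
  ...   | no  u∉ = (e , y) ∷ ss , ((j , walk) , last , ¬Any⇒All¬ _ u∉ ∷ uniq) , c ∷ circ

  CC-sym : CircularlyConnected G u v → CircularlyConnected G v u
  CC-sym = star⇒CC ∘ reverseStar circularAdj-sym ∘ CC⇒star

  CC-trans : CircularlyConnected G u v → CircularlyConnected G v w → CircularlyConnected G u w
  CC-trans p q = star⇒CC (CC⇒star p ◅◅ CC⇒star q)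

  CC⇒reach : CircularlyConnected G u v → Reach s u v
  -- The one-term trail is a start for either sign `s`.
  CC⇒reach = reach-star (_ , [] , nil , []) ∘ CC⇒star

  -- As a route, the given ditrail has start sign `α` and end sign `neg α`, so following it to
  -- either end produces final sign `α`.
  ditrail-via : CircularlyConnected G v u → Ditrail G α α u w →
                Ditrail G α α v w ⊎ Ditrail G α α v u
  ditrail-via v-u d with ditrail⇒trail d | CC⇒reach v-u
  ... | _ , p , uniq | _ , q =
    [ inj₁ ∘ trail⇒ditrail , inj₂ ∘ trail⇒ditrail ]′ (divert q p uniq (split nil p))

  sim-sym : Sim G α u v → Sim G α v u
  sim-sym (inj₁ refl)      = inj₁ refl
  sim-sym (inj₂ (cc , ¬d)) = inj₂ (CC-sym cc , ¬d ∘ ditrail-sym)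

  sim-trans : Sim G α u v → Sim G α v w → Sim G α u w
  sim-trans (inj₁ refl) q           = q
  sim-trans p           (inj₁ refl) = p
  sim-trans (inj₂ (u-v , ¬uv)) (inj₂ (v-w , ¬vw)) =
    inj₂ (CC-trans u-v v-w , λ d →
      -- From `v`, the ditrail `d` would yield one to `w` or one to `u`; both are excluded.
      [ ¬vw , ¬uv ∘ ditrail-sym ]′ (ditrail-via (CC-sym u-v) d))

theorem5p4 : (G : BiGraph) (α : Sign) → IsEquivalence (Sim G α)
theorem5p4 G α = record
  { refl  = inj₁ refl
  ; sym   = sim-sym G
  ; trans = sim-trans G
  }
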